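{- Let $n\ge 1$, let $K_n$ be the complete graph on the vertices $v_1,\dots,v_n$, and let $g$ be a proper vertex coloring of $K_n$ by positive integers (so $g(v_1),\dots,g(v_n)$ are pairwise distinct positive integers). Then $g$ is a graceful coloring of $K_n$ if and only if the set $\{g(v_i) : 1\le i\le n\}$ is $3$-AP-free.
   Context: For a positive integer $l$, write $[1,l]=\{1,2,\dots,l\}$. A graceful coloring of a simple graph $G$ is a proper vertex coloring $g:V(G)\to[1,l]$, for some integer $l\ge 2$ (adjacent vertices receive distinct values), such that the induced edge coloring $g^*:E(G)\to[1,l-1]$, $g^*(ab)=|g(a)-g(b)|$ for each edge $ab$, is a proper edge coloring (any two distinct edges sharing an endpoint receive distinct values). A set (or sequence) of integers is $3$-AP-free if it contains no three distinct terms $a,b,c$ with $|b-a|=|c-b|$, i.e. no three-term arithmetic progression. -}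

module Defs where

open import Data.Fin.Base using (Fin)
open import Data.Integer.Base as ℤ using (ℤ; +_)
open import Data.Nat.Base using (ℕ; _∸_; _≤_; ∣_-_∣)
open import Data.Product.Base using (_×_; ∃-syntax)
open import Data.Sum.Base using (_⊎_)
open import Level using (0ℓ)
open import Relation.Binary.Core using (Rel)
open import Relation.Binary.Definitions using (Irreflexive; Symmetric)
open import Relation.Binary.PropositionalEquality using (_≡_; _≢_; ≢-sym)
open import Relation.Nullary.Negation using (¬_)
open import Relation.Unary using (Pred)

record SimpleGraph (V : Set) : Set₁ where
  field
    Adj    : Rel V 0ℓ
    sym    : Symmetric Adj
    irrefl : Irreflexive _≡_ Adj

complete : ∀ n → SimpleGraph (Fin n)
complete n = record
  { Adj    = _≢_
  ; sym    = ≢-sym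
  ; irrefl = λ u≡v u≢v → u≢v u≡v
  }

InRange : ℕ → Pred ℕ 0ℓ
InRange l x = 1 ≤ x × x ≤ l

module _ {V : Set} (G : SimpleGraph V) where
  open SimpleGraph G

  -- An edge is presented by an ordering of its two endpoints; the unordered
  -- edge is recovered by comparing presentations with _≈ₑ_.
  record Edge : Set where
    constructor edge
    field
      end₁ end₂ : V
      adjacent  : Adj end₁ end₂

  open Edge

  _≈ₑ_ : Rel Edge 0ℓ
  e ≈ₑ f = (end₁ e ≡ end₁ f × end₂ e ≡ end₂ f)
         ⊎ (end₁ e ≡ end₂ f × end₂ e ≡ end₁ f)

  _IsEndpointOf_ : V → Edge → Set
  v IsEndpointOf e = v ≡ end₁ e ⊎ v ≡ end₂ e

  ShareEndpoint : Rel Edge 0ℓ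
  ShareEndpoint e f = ∃[ v ] (v IsEndpointOf e × v IsEndpointOf f)

  IsProperVertexColoring : (V → ℕ) → Set
  IsProperVertexColoring g = ∀ {u v} → Adj u v → g u ≢ g v

  record IsProperEdgeColoring (c : Edge → ℕ) : Set where
    field
      -- c is a function of the unordered edge.
      cong   : ∀ {e f} → e ≈ₑ f → c e ≡ c f
      proper : ∀ {e f} → ¬ (e ≈ₑ f) → ShareEndpoint e f → c e ≢ c f

  inducedEdgeColoring : (V → ℕ) → Edge → ℕ
  inducedEdgeColoring g e = ∣ g (end₁ e) - g (end₂ e) ∣

  record IsGracefulColoring (g : V → ℕ) : Set where
    field
      l            : ℕ
      2≤l          : 2 ≤ l
      vertexRange  : ∀ v → InRange l (g v)
      vertexProper : IsProperVertexColoring g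
      edgeRange    : ∀ e → InRange (l ∸ 1) (inducedEdgeColoring g e)
      edgeProper   : IsProperEdgeColoring (inducedEdgeColoring g)

ThreeAPFree : Pred ℤ 0ℓ → Set
ThreeAPFree S = ∀ {a b c} → S a → S b → S c →
  a ≢ b → b ≢ c → a ≢ c → ℤ.∣ b ℤ.- a ∣ ≢ ℤ.∣ c ℤ.- b ∣

valueSet : {V : Set} → (V → ℕ) → Pred ℤ 0ℓ
valueSet g x = ∃[ v ] x ≡ + g v

{-# OPTIONS --safe #-}
module Submission where

-- In a complete graph, two distinct edges sharing an endpoint form a path
-- u – v – w on three distinct vertices. They receive the same colour exactly
-- when g v is equidistant from g u and g w, that is, when these three values
-- violate 3-AP-freeness.

open import Defs
open import Data.Fin.Base using (Fin)
open import Data.Integer.Base as ℤ using (+_)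
open import Data.Integer.Properties
  using (m-n≡m⊖n; [1+m]⊖[1+n]≡m⊖n; +-injective)
open import Data.List.Base using (tabulate)
open import Data.List.Extrema.Nat using (max; xs≤max)
open import Data.List.Relation.Unary.All.Properties using (tabulate⁻)
open import Data.Nat.Base using (ℕ; zero; suc; _≤_; ∣_-_∣; z≤n; s≤s)
open import Data.Nat.Properties
  using (∣-∣-comm; ∣m-n∣≤m⊔n; ∣m-n∣≡0⇒m≡n; ⊔-lub; ≤-trans; m≤n⇒m≤1+n; n≢0⇒n>0)
open import Data.Product.Base using (_,_; ∃-syntax)
open import Data.Sum.Base using (inj₁; inj₂)
open import Function.Base using (_∘_)
open import Function.Bundles using (_⇔_; mk⇔)
open import Relation.Binary.PropositionalEquality
  using (_≡_; _≢_; refl; sym; trans; cong; ≢-sym)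
open import Relation.Nullary.Negation using (¬_)

∣⊖∣≡∣-∣ : ∀ m n → ℤ.∣ m ℤ.⊖ n ∣ ≡ ∣ m - n ∣
∣⊖∣≡∣-∣ zero    zero    = refl
∣⊖∣≡∣-∣ zero    (suc n) = refl
∣⊖∣≡∣-∣ (suc m) zero    = refl
∣⊖∣≡∣-∣ (suc m) (suc n) =
  trans (cong ℤ.∣_∣ ([1+m]⊖[1+n]≡m⊖n m n)) (∣⊖∣≡∣-∣ m n)

∣+m-+n∣≡∣m-n∣ : ∀ m n → ℤ.∣ + m ℤ.- + n ∣ ≡ ∣ m - n ∣
∣+m-+n∣≡∣m-n∣ m n = trans (cong ℤ.∣_∣ (m-n≡m⊖n m n)) (∣⊖∣≡∣-∣ m n)

boundedAbove : ∀ {n} (g : Fin n → ℕ) → ∃[ b ] (∀ v → g v ≤ b)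
-- The default 0 covers the empty list and never raises the maximum of a nonempty one.
boundedAbove g = max 0 (tabulate g) , tabulate⁻ (xs≤max 0 (tabulate g))

module _ {n : ℕ} (g : Fin n → ℕ) where

  private
    K = complete n

  -- The pivot between the two sides: it mentions neither edges nor integers, and the middle vertex
  -- is always `v`.
  SeparatesPaths : Set
  SeparatesPaths = ∀ {u v w} → u ≢ v → v ≢ w → u ≢ w →
    ∣ g u - g v ∣ ≢ ∣ g v - g w ∣

  edgeProper⇒separatesPaths :
    IsProperEdgeColoring K (inducedEdgeColoring K g) → SeparatesPaths
  edgeProper⇒separatesPaths p {u} {v} {w} u≢v v≢w u≢w =
    IsProperEdgeColoring.proper p
      {edge u v u≢v} {edge v w v≢w}
      -- Matching the edges in the same direction would force `u ≡ v`, matching them reversed would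
      -- force `u ≡ w`.
      (λ { (inj₁ (u≡v , _)) → u≢v u≡v ; (inj₂ (u≡w , _)) → u≢w u≡w })
      (v , inj₂ refl , inj₁ refl)

  separatesPaths⇒edgeProper :
    SeparatesPaths → IsProperEdgeColoring K (inducedEdgeColoring K g)
  separatesPaths⇒edgeProper sep = record
    { cong   = λ {e} {f} → colour-cong {e} {f}
    ; proper = λ {e} {f} → colour-proper {e} {f}
    }
    where
    colour-cong : ∀ {e f} → _≈ₑ_ K e f →
      inducedEdgeColoring K g e ≡ inducedEdgeColoring K g f
    colour-cong (inj₁ (refl , refl)) = refl
    colour-cong {edge a b _} (inj₂ (refl , refl)) = ∣-∣-comm (g a) (g b)

    -- The four cases say which ends coincide. Reversing edges by `∣-∣-comm` puts the shared vertex
    -- in the middle; the two outer vertices differ, as otherwise both edges would be the same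
    -- unordered edge.
    colour-proper : ∀ {e f} → ¬ (_≈ₑ_ K e f) → ShareEndpoint K e f →
      inducedEdgeColoring K g e ≢ inducedEdgeColoring K g f
    colour-proper {edge a b a≢b} {edge c d c≢d} e≉f (_ , inj₁ refl , inj₁ refl) eq =
      sep (≢-sym a≢b) c≢d (λ b≡d → e≉f (inj₁ (refl , b≡d)))
        (trans (∣-∣-comm (g b) (g a)) eq)
    colour-proper {edge a b a≢b} {edge c d c≢d} e≉f (_ , inj₁ refl , inj₂ refl) eq =
      sep (≢-sym a≢b) (≢-sym c≢d) (λ b≡c → e≉f (inj₂ (refl , b≡c)))
        (trans (∣-∣-comm (g b) (g a)) (trans eq (∣-∣-comm (g c) (g d))))
    colour-proper {edge a b a≢b} {edge c d c≢d} e≉f (_ , inj₂ refl , inj₁ refl) eq =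
      sep a≢b c≢d (λ a≡d → e≉f (inj₂ (a≡d , refl))) eq
    colour-proper {edge a b a≢b} {edge c d c≢d} e≉f (_ , inj₂ refl , inj₂ refl) eq =
      sep a≢b (≢-sym c≢d) (λ a≡c → e≉f (inj₁ (a≡c , refl)))
        (trans eq (∣-∣-comm (g c) (g d)))

  -- The swap reconciles `ThreeAPFree`, which subtracts the earlier term from the later one, with
  -- the order used for edge colours.
  integerDistance : ∀ u v → ℤ.∣ + g v ℤ.- + g u ∣ ≡ ∣ g u - g v ∣
  integerDistance u v = trans (∣+m-+n∣≡∣m-n∣ (g v) (g u)) (∣-∣-comm (g v) (g u))

  separatesPaths⇒3APFree : SeparatesPaths → ThreeAPFree (valueSet g)
  separatesPaths⇒3APFree sep (u , refl) (v , refl) (w , refl) a≢b b≢c a≢c eq =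
    sep (a≢b ∘ cong (+_ ∘ g)) (b≢c ∘ cong (+_ ∘ g)) (a≢c ∘ cong (+_ ∘ g))
      (trans (sym (integerDistance u v)) (trans eq (integerDistance v w)))

  -- On a complete graph properness is injectivity, so distinct vertices give the distinct terms
  -- that 3-AP-freeness speaks of.
  3APFree⇒separatesPaths : IsProperVertexColoring K g →
    ThreeAPFree (valueSet g) → SeparatesPaths
  3APFree⇒separatesPaths g-proper free {u} {v} {w} u≢v v≢w u≢w eq =
    free (u , refl) (v , refl) (w , refl)
      (g-proper u≢v ∘ +-injective) (g-proper v≢w ∘ +-injective) (g-proper u≢w ∘ +-injective)
      (trans (integerDistance u v) (trans eq (sym (integerDistance v w))))

  edgeProper⇒graceful : (∀ v → 1 ≤ g v) → IsProperVertexColoring K g →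
    IsProperEdgeColoring K (inducedEdgeColoring K g) → IsGracefulColoring K g
  edgeProper⇒graceful g-pos g-proper e-proper with b , g≤b ← boundedAbove g = record
    -- Two above the bound, so that `2 ≤ l` holds whatever `b` is; edge colours are at most `b`,
    -- hence at most `l ∸ 1`.
    { l            = suc (suc b)
    ; 2≤l          = s≤s (s≤s z≤n)
    ; vertexRange  = λ v → g-pos v , m≤n⇒m≤1+n (m≤n⇒m≤1+n (g≤b v))
    ; vertexProper = g-proper
    ; edgeRange    = λ (edge u v u≢v) →
        n≢0⇒n>0 (g-proper u≢v ∘ ∣m-n∣≡0⇒m≡n) ,
        m≤n⇒m≤1+n (≤-trans (∣m-n∣≤m⊔n (g u) (g v)) (⊔-lub (g≤b u) (g≤b v)))
    ; edgeProper   = e-proper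
    }

theorem2p4 : ∀ (n : ℕ) → 1 ≤ n → (g : Fin n → ℕ) → (∀ v → 1 ≤ g v) →
    IsProperVertexColoring (complete n) g →
    IsGracefulColoring (complete n) g ⇔ ThreeAPFree (valueSet g)
theorem2p4 n _ g g-pos g-proper = mk⇔
  (separatesPaths⇒3APFree g ∘ edgeProper⇒separatesPaths g ∘ IsGracefulColoring.edgeProper)
  (edgeProper⇒graceful g g-pos g-proper ∘ separatesPaths⇒edgeProper g
    ∘ 3APFree⇒separatesPaths g g-proper)
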